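{- For every real $\beta$ with $0<\beta\le \frac{3}{10}$, the asymptotic competitive search ratio satisfies $\hat S(\beta)\le 2$.
   Context: Model. $n$ robots with distinct identities start at time $0$ at the origin of the real line and move along the line with speed at most $1$, changing direction or speed at no cost. A target lies at an unknown point at distance $d>0$ from the origin, i.e. at $d$ or $-d$, with $d$ unknown to the robots. At most $f$ robots are faulty; the bound $f$ is known, but not which robots are faulty. A search algorithm assigns each robot a trajectory, known to all robots; a robot's further motion may depend on the messages broadcast so far (computation and communication take no time). A robot detects whether the target is at a point only by being there. The only messages are announcements "the target is here", heard instantly by all robots at any distance; each message automatically carries the true identity and true current location of its sender. A robot visiting a point silently is taken to claim that the target is not there. Reliable (non-faulty) robots follow the algorithm and report truthfully. Faulty robots are controlled by an adversary: they may stay silent at the target or announce the target where it is not; a faulty robot that broadcasts while off its assigned trajectory is thereby detected as faulty. The search is completed at the first time when some reliable robot has visited the target and announced it and all reliable robots can be certain of its location (every scenario with at most $f$ faulty robots consistent with the messages so far has the target at that location). For an algorithm, the search time $S_d(n,f)$ is the worst-case completion time over both positions $\pm d$ of the target, all choices of at most $f$ faulty robots, and all behaviours of the faulty robots. The inequality $S_d(n,f)\le cd$ means that there is an algorithm, not depending on $d$, with search time at most $cd$ for every $d>0$. Asymptotic ratio. For non-integer $n$, $S_d(n,f)$ means $S_d(\lceil n\rceil,f)$ ($f$ is always an integer). For a density $\beta=f/n>0$ of faulty robots, $$\hat S(\beta)=\min\{\alpha \mid \exists \text{ a constant } c_\beta \text{ such that for all integers } f>0,\ S_d(f/\beta+c_\beta,f)\le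 \alpha d\}.$$ -}

module Defs where

open import Algebra.Structures using (IsCommutativeRing)
open import Data.Fin using (Fin)
open import Data.Fin.Subset using (Subset; _∉_; ∣_∣)
open import Data.Maybe using (Maybe; just)
open import Data.Nat as ℕ using (ℕ; zero; suc)
open import Data.Product using (Σ-syntax; ∃; _×_)
open import Data.Sum using (_⊎_)
open import Relation.Binary.PropositionalEquality using (_≡_; _≢_)
open import Relation.Binary.Structures using (IsTotalOrder)

-- The real numbers, characterised (up to isomorphism) as a Dedekind-complete
-- totally ordered field.  The inverse is total, with an unspecified value at 0#.
record CompleteOrderedField : Set₁ where
  infix  8 _⁻¹ -_
  infixl 7 _*_ _/_
  infixl 6 _+_ _-_
  infix  4 _≤_ _<_
  field
    Carrier           : Set
    _+_ _*_           : Carrier → Carrier → Carrier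
    -_ _⁻¹            : Carrier → Carrier
    0# 1#             : Carrier
    _≤_               : Carrier → Carrier → Set
    isCommutativeRing : IsCommutativeRing _≡_ _+_ _*_ -_ 0# 1#
    0≢1               : 0# ≢ 1#
    *-inverseʳ        : ∀ x → x ≢ 0# → x * x ⁻¹ ≡ 1#
    isTotalOrder      : IsTotalOrder _≡_ _≤_
    +-monoˡ-≤         : ∀ z {x y} → x ≤ y → x + z ≤ y + z
    *-nonNegative     : ∀ {x y} → 0# ≤ x → 0# ≤ y → 0# ≤ x * y

  IsUpperBound : (Carrier → Set) → Carrier → Set
  IsUpperBound P u = ∀ x → P x → x ≤ u

  field
    supremum : (P : Carrier → Set) → ∃ P → ∃ (IsUpperBound P) →
               Σ[ s ∈ Carrier ] IsUpperBound P s × (∀ u → IsUpperBound P u → s ≤ u)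

  _<_ : Carrier → Carrier → Set
  x < y = x ≤ y × x ≢ y

  _-_ _/_ : Carrier → Carrier → Carrier
  x - y = x + - y
  x / y = x * y ⁻¹

  fromℕ : ℕ → Carrier
  fromℕ zero    = 0#
  fromℕ (suc n) = 1# + fromℕ n

module Search (R : CompleteOrderedField) where
  open CompleteOrderedField R renaming (Carrier to ℝ)

  -- Times are real numbers; only times t with 0# ≤ t are ever constrained or
  -- consulted.

  record IsTrajectory (p : ℝ → ℝ) : Set where
    field
      start : p 0# ≡ 0#
      speed : ∀ s t → 0# ≤ s → s ≤ t →
              (p t - p s ≤ t - s) × (p s - p t ≤ t - s)

  -- L t i ≡ just x : at time t robot i announces "the target is here" while
  -- located at x.  No finiteness or discreteness is imposed, so that faulty
  -- robots may announce at any set of times.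
  Log : ℕ → Set
  Log n = ℝ → Fin n → Maybe ℝ

  AgreeBefore AgreeUpTo : ∀ {n} → ℝ → Log n → Log n → Set
  AgreeBefore t L L′ = ∀ s i → 0# ≤ s → s < t → L s i ≡ L′ s i
  AgreeUpTo   t L L′ = ∀ s i → 0# ≤ s → s ≤ t → L s i ≡ L′ s i

  -- A message heard at time t can change the motion from t onwards but, speeds
  -- being bounded, not the position at t: hence AgreeBefore in causal.
  record Algorithm (n : ℕ) : Set where
    field
      position     : Log n → Fin n → ℝ → ℝ
      isTrajectory : ∀ L i → IsTrajectory (position L i)
      causal       : ∀ t L L′ → 0# ≤ t → AgreeBefore t L L′ →
                     ∀ i → position L i t ≡ position L′ i t

  -- A scenario with at most f faulty robots.  Jointly, located, truthful and
  -- reports say that a reliable robot announces the target at its first visit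
  -- to it and never announces anything false.  It may or may not repeat the
  -- announcement on later visits.  (Demanding an announcement at every instant
  -- spent at the target would leave some causal algorithms without any
  -- execution: a robot could be told to stay at the target for as long as it
  -- has not repeated its announcement, and to leave it otherwise.)
  record Execution {n : ℕ} (A : Algorithm n) (f : ℕ) : Set where
    open Algorithm A
    field
      target   : ℝ
      target≢0 : target ≢ 0#
      faulty   : Subset n
      ∣faulty∣ : ∣ faulty ∣ ℕ.≤ f
      log      : Log n
      actual   : Fin n → ℝ → ℝ
      moves    : ∀ i → IsTrajectory (actual i)
      located  : ∀ i t x → 0# ≤ t → log t i ≡ just x → x ≡ actual i t
      follows  : ∀ i → i ∉ faulty → ∀ t → 0# ≤ t → actual i t ≡ position log i t
      truthful : ∀ i → i ∉ faulty → ∀ t x → 0# ≤ t → log t i ≡ just x → x ≡ target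
      reports  : ∀ i → i ∉ faulty → ∀ t → 0# ≤ t → actual i t ≡ target →
                 Σ[ s ∈ ℝ ] 0# ≤ s × s ≤ t × log s i ≡ just target

  module _ {n : ℕ} {A : Algorithm n} {f : ℕ} (E : Execution A f) where
    open Execution

    Found : ℝ → Set
    Found t = Σ[ i ∈ Fin n ] i ∉ faulty E ×
              (Σ[ s ∈ ℝ ] 0# ≤ s × s ≤ t ×
                 actual E i s ≡ target E × log E s i ≡ just (target E))

    Certain : ℝ → Set
    Certain t = (E′ : Execution A f) → AgreeUpTo t (log E) (log E′) →
                target E′ ≡ target E

    CompletedAt : ℝ → Set
    CompletedAt t = Found t × Certain t

    -- CompletedAt is upward closed, so this says that the completion time is
    -- at most b.
    CompletedBy : ℝ → Set
    CompletedBy b = Σ[ t ∈ ℝ ] 0# ≤ t × t ≤ b × CompletedAt t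

  SearchTime≤ : ∀ {n} → Algorithm n → (f : ℕ) (d b : ℝ) → Set
  SearchTime≤ A f d b = (E : Execution A f) →
    Execution.target E ≡ d ⊎ Execution.target E ≡ - d → CompletedBy E b

  -- S_d(n , f) ≤ c d
  S[_,_]≤_·d : ℕ → ℕ → ℝ → Set
  S[ n , f ]≤ c ·d =
    Σ[ A ∈ Algorithm n ] (∀ d → 0# < d → SearchTime≤ A f d (c * d))

  IsCeiling : ℝ → ℕ → Set
  IsCeiling x n = x ≤ fromℕ n × fromℕ n < x + 1#

  -- The set of α whose minimum is Ŝ(β).
  Admissible : ℝ → ℝ → Set
  Admissible β α = Σ[ c ∈ ℝ ] (∀ f → 0 ℕ.< f →
    Σ[ n ∈ ℕ ] IsCeiling (fromℕ f / β + c) n × S[ n , f ]≤ α ·d)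

  -- Ŝ(β) ≤ a: the minimum of a set is at most a exactly when some element is.
  Ŝ[_]≤_ : ℝ → ℝ → Set
  Ŝ[ β ]≤ a = Σ[ α ∈ ℝ ] Admissible β α × α ≤ a

{-# OPTIONS --safe #-}

-- With a = ⌊4f/3⌋ + 1, let a robots run right and a robots run left at full
-- speed, and let the others wait at the origin; with 10f/3 + 2 robots in total,
-- more than 2f lie outside each running group.  Call the vote of a running group
-- at a point a conflict if both opinions could be true, i.e. are held by at least
-- a − f robots each.  A conflict reveals a − f faulty robots in that group,
-- whatever the truth, and sends the waiting robots after that group.  Without a
-- conflict at the target the vote there is decisive.  If the other side has no
-- conflict in time, the waiting robots reach the target by time 2d and more than
-- 2f robots have visited it.  If both sides have a conflict, then two scenarios
-- with different targets that explain the same messages would together have at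
-- most 2(f − (a − f)) faulty robots in the group that visited the target, which
-- is less than a.
module Submission where

open import Defs
open import Algebra.Bundles using (CommutativeRing)
import Algebra.Properties.Ring
import Algebra.Properties.Semiring.Mult
import Algebra.Solver.Ring.NaturalCoefficients.Default
open import Axiom.ExcludedMiddle using (ExcludedMiddle)
open import Data.Empty using (⊥; ⊥-elim)
open import Data.Fin using (Fin)
open import Data.Fin.Subset using (Subset; inside; outside; ∣_∣; _∈_; _∉_; _⊆_; _∪_; _∩_; ∁; ⊤)
open import Data.Fin.Subset.Properties
open import Data.Maybe using (Maybe; just)
open import Data.Nat as ℕ using (ℕ; zero; suc)
import Data.Nat.DivMod as ℕ
import Data.Nat.Properties as ℕ
open import Data.Nat.Solver using (module +-*-Solver)
open import Data.Product using (Σ-syntax; ∃; _×_; _,_; proj₁; proj₂)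
open import Data.Sum using (_⊎_; inj₁; inj₂)
open import Data.Vec using ([]; _∷_; tabulate)
open import Data.Vec.Properties using (lookup∘tabulate; lookup⇒[]=; []=⇒lookup)
open import Function using (_∘_)
open import Level using (0ℓ)
open import Relation.Binary.Bundles using (Poset)
open import Relation.Binary.PropositionalEquality
  using (_≡_; _≢_; refl; sym; trans; cong; cong₂; subst; subst₂)
open import Relation.Binary.Structures using (IsTotalOrder)
import Relation.Binary.Reasoning.PartialOrder
open import Relation.Nullary using (¬_; Dec; yes; no; does; contradiction)
open import Relation.Nullary.Decidable using (dec-true; decidable-stable)

-- Cardinalities of finite subsets.

∣p∪q∣≤∣p∣+∣q∣ : ∀ {n} (p q : Subset n) → ∣ p ∪ q ∣ ℕ.≤ ∣ p ∣ ℕ.+ ∣ q ∣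
∣p∪q∣≤∣p∣+∣q∣ []            []            = ℕ.z≤n
∣p∪q∣≤∣p∣+∣q∣ (inside ∷ p)  (inside ∷ q)  =
  ℕ.s≤s (ℕ.≤-trans (∣p∪q∣≤∣p∣+∣q∣ p q) (ℕ.+-monoʳ-≤ ∣ p ∣ (ℕ.n≤1+n ∣ q ∣)))
∣p∪q∣≤∣p∣+∣q∣ (inside ∷ p)  (outside ∷ q) = ℕ.s≤s (∣p∪q∣≤∣p∣+∣q∣ p q)
∣p∪q∣≤∣p∣+∣q∣ (outside ∷ p) (inside ∷ q)  =
  ℕ.≤-trans (ℕ.s≤s (∣p∪q∣≤∣p∣+∣q∣ p q)) (ℕ.≤-reflexive (sym (ℕ.+-suc ∣ p ∣ ∣ q ∣)))
∣p∪q∣≤∣p∣+∣q∣ (outside ∷ p) (outside ∷ q) = ∣p∪q∣≤∣p∣+∣q∣ p q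

∣p∩q∣+∣p∩∁q∣≡∣p∣ : ∀ {n} (p q : Subset n) → ∣ p ∩ q ∣ ℕ.+ ∣ p ∩ ∁ q ∣ ≡ ∣ p ∣
∣p∩q∣+∣p∩∁q∣≡∣p∣ []            []            = refl
∣p∩q∣+∣p∩∁q∣≡∣p∣ (inside ∷ p)  (inside ∷ q)  = cong suc (∣p∩q∣+∣p∩∁q∣≡∣p∣ p q)
∣p∩q∣+∣p∩∁q∣≡∣p∣ (inside ∷ p)  (outside ∷ q) =
  trans (ℕ.+-suc ∣ p ∩ q ∣ _) (cong suc (∣p∩q∣+∣p∩∁q∣≡∣p∣ p q))
∣p∩q∣+∣p∩∁q∣≡∣p∣ (outside ∷ p) (_ ∷ q)       = ∣p∩q∣+∣p∩∁q∣≡∣p∣ p q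

disjoint⇒∣p∩q∣+∣p∩r∣≤∣p∣ : ∀ {n} (p : Subset n) {q r} → r ⊆ ∁ q →
                           ∣ p ∩ q ∣ ℕ.+ ∣ p ∩ r ∣ ℕ.≤ ∣ p ∣
disjoint⇒∣p∩q∣+∣p∩r∣≤∣p∣ p {q} {r} r⊆∁q = begin
  ∣ p ∩ q ∣ ℕ.+ ∣ p ∩ r ∣   ≤⟨ ℕ.+-monoʳ-≤ ∣ p ∩ q ∣ (p⊆q⇒∣p∣≤∣q∣ p∩r⊆p∩∁q) ⟩
  ∣ p ∩ q ∣ ℕ.+ ∣ p ∩ ∁ q ∣ ≡⟨ ∣p∩q∣+∣p∩∁q∣≡∣p∣ p q ⟩
  ∣ p ∣                     ∎
  where
  open ℕ.≤-Reasoning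
  p∩r⊆p∩∁q : p ∩ r ⊆ p ∩ ∁ q
  p∩r⊆p∩∁q i∈ = let i∈p , i∈r = x∈p∩q⁻ p r i∈ in x∈p∩q⁺ (i∈p , r⊆∁q i∈r)

subset-of-size : ∀ {n} m (p : Subset n) → m ℕ.≤ ∣ p ∣ →
                 Σ[ q ∈ Subset n ] q ⊆ p × ∣ q ∣ ≡ m
subset-of-size zero    []            _         = [] , ⊆-refl , refl
subset-of-size m       (outside ∷ p) m≤        =
  let q , q⊆p , ∣q∣≡m = subset-of-size m p m≤ in outside ∷ q , s⊆s q⊆p , ∣q∣≡m
subset-of-size zero    (inside ∷ p)  _         =
  let q , q⊆p , ∣q∣≡0 = subset-of-size 0 p ℕ.z≤n in outside ∷ q , out⊆ q⊆p , ∣q∣≡0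
subset-of-size (suc m) (inside ∷ p)  (ℕ.s≤s m≤) =
  let q , q⊆p , ∣q∣≡m = subset-of-size m p m≤ in inside ∷ q , s⊆s q⊆p , cong suc ∣q∣≡m

module _ {n : ℕ} {P : Fin n → Set} (P? : ∀ i → Dec (P i)) where

  comprehension : Subset n
  comprehension = tabulate (does ∘ P?)

  ∈-comprehension⁺ : ∀ {i} → P i → i ∈ comprehension
  ∈-comprehension⁺ {i} Pi =
    lookup⇒[]= i _ (trans (lookup∘tabulate (does ∘ P?) i) (dec-true (P? i) Pi))

  ∈-comprehension⁻ : ∀ {i} → i ∈ comprehension → P i
  ∈-comprehension⁻ {i} i∈
    with P? i | trans (sym (lookup∘tabulate (does ∘ P?) i)) ([]=⇒lookup i∈)
  ... | yes Pi | _  = Pi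
  ... | no  _  | ()

-- Arithmetic of a complete ordered field, and rounding to natural numbers.

module OrderedField (R : CompleteOrderedField) where
  open CompleteOrderedField R

  commutativeRing : CommutativeRing 0ℓ 0ℓ
  commutativeRing = record { isCommutativeRing = isCommutativeRing }

  poset : Poset 0ℓ 0ℓ 0ℓ
  poset = record { isPartialOrder = IsTotalOrder.isPartialOrder isTotalOrder }

  open CommutativeRing commutativeRing public
    using (+-comm; +-assoc; +-identityˡ; +-identityʳ; *-comm; *-assoc; *-identityˡ;
           *-identityʳ; distribˡ; distribʳ; zeroˡ; -‿inverseʳ)
  open CommutativeRing commutativeRing using (ring; semiring; commutativeSemiring)
  open Algebra.Properties.Ring ring public
    using (-‿distribʳ-*; -‿+-comm)
    renaming (-‿involutive to neg-involutive; -‿injective to neg-injective;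
              -0#≈0# to -0≡0)
  open Algebra.Properties.Semiring.Mult semiring using (×-homo-+; ×1-homo-*) renaming (_×_ to _×ℕ_)
  open IsTotalOrder isTotalOrder public using (total)
    renaming (refl to ≤-refl; reflexive to ≤-reflexive; trans to ≤-trans; antisym to ≤-antisym)
  module ≤-Reasoning = Relation.Binary.Reasoning.PartialOrder poset
  module Solver = Algebra.Solver.Ring.NaturalCoefficients.Default commutativeSemiring

  open ≤-Reasoning

  <-≤-trans : ∀ {x y z} → x < y → y ≤ z → x < z
  <-≤-trans (x≤y , x≢y) y≤z = ≤-trans x≤y y≤z , λ { refl → x≢y (≤-antisym x≤y y≤z) }

  +-monoʳ-≤ : ∀ z {x y} → x ≤ y → z + x ≤ z + y
  +-monoʳ-≤ z {x} {y} x≤y = subst₂ _≤_ (+-comm x z) (+-comm y z) (+-monoˡ-≤ z x≤y)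

  +-mono-≤ : ∀ {w x y z} → w ≤ x → y ≤ z → w + y ≤ x + z
  +-mono-≤ {x = x} {y = y} w≤x y≤z = ≤-trans (+-monoˡ-≤ y w≤x) (+-monoʳ-≤ x y≤z)

  x+y+z≡x+z+y : ∀ x y z → x + y + z ≡ x + z + y
  x+y+z≡x+z+y = Solver.solve 3 (λ x y z → x :+ y :+ z := x :+ z :+ y) refl
    where open Solver

  [x-y]+y≡x : ∀ x y → (x - y) + y ≡ x
  [x-y]+y≡x x y = trans (+-assoc x (- y) y)
    (trans (cong (x +_) (trans (+-comm (- y) y) (-‿inverseʳ y))) (+-identityʳ x))

  [x+y]-y≡x : ∀ x y → (x + y) - y ≡ x
  [x+y]-y≡x x y = trans (+-assoc x y (- y)) (trans (cong (x +_) (-‿inverseʳ y)) (+-identityʳ x))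

  +-cancelʳ-≤ : ∀ z {x y} → x + z ≤ y + z → x ≤ y
  +-cancelʳ-≤ z {x} {y} le = subst₂ _≤_ ([x+y]-y≡x x z) ([x+y]-y≡x y z) (+-monoˡ-≤ (- z) le)

  x≤y+z⇒x-z≤y : ∀ {x y} z → x ≤ y + z → x - z ≤ y
  x≤y+z⇒x-z≤y {x} {y} z le = subst (x - z ≤_) ([x+y]-y≡x y z) (+-monoˡ-≤ (- z) le)

  x≤y⇒0≤y-x : ∀ {x y} → x ≤ y → 0# ≤ y - x
  x≤y⇒0≤y-x {x} {y} x≤y = subst (_≤ y - x) (-‿inverseʳ x) (+-monoˡ-≤ (- x) x≤y)

  x≤x+y : ∀ x {y} → 0# ≤ y → x ≤ x + y
  x≤x+y x {y} 0≤y = subst (_≤ x + y) (+-identityʳ x) (+-monoʳ-≤ x 0≤y)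

  neg-mono-≤ : ∀ {x y} → x ≤ y → - y ≤ - x
  neg-mono-≤ {x} {y} x≤y = +-cancelʳ-≤ (x + y) (subst₂ _≤_
    (sym (trans (+-comm (- y) (x + y)) ([x+y]-y≡x x y)))
    (sym (trans (cong (- x +_) (+-comm x y)) (trans (+-comm (- x) (y + x)) ([x+y]-y≡x y x))))
    x≤y)

  -- If `1# ≤ 0#`, then `- 1#` is nonnegative, and so is its square, which is `1#`.
  0≤1 : 0# ≤ 1#
  0≤1 with total 0# 1#
  ... | inj₁ 0≤1 = 0≤1
  ... | inj₂ 1≤0 = subst (0# ≤_)
    (trans (sym (-‿distribʳ-* (- 1#) 1#)) (trans (cong -_ (*-identityʳ (- 1#))) (neg-involutive 1#)))
    (*-nonNegative 0≤-1 0≤-1)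
    where
    0≤-1 : 0# ≤ - 1#
    0≤-1 = subst (_≤ - 1#) -0≡0 (neg-mono-≤ 1≤0)

  1≰0 : ¬ 1# ≤ 0#
  1≰0 1≤0 = 0≢1 (≤-antisym 0≤1 1≤0)

  1+x≰x : ∀ x → ¬ 1# + x ≤ x
  1+x≰x x le = 1≰0 (+-cancelʳ-≤ x (subst (1# + x ≤_) (sym (+-identityˡ x)) le))

  *-monoˡ-≤ : ∀ {x y} z → 0# ≤ z → x ≤ y → z * x ≤ z * y
  *-monoˡ-≤ {x} {y} z 0≤z x≤y = +-cancelʳ-≤ (- (z * x)) (subst₂ _≤_
    (sym (-‿inverseʳ (z * x)))
    (trans (distribˡ z y (- x)) (cong (z * y +_) (sym (-‿distribʳ-* z x))))
    (*-nonNegative 0≤z (x≤y⇒0≤y-x x≤y)))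

  0<x⇒0≤x⁻¹ : ∀ {x} → 0# < x → 0# ≤ x ⁻¹
  0<x⇒0≤x⁻¹ {x} (0≤x , 0≢x) with total 0# (x ⁻¹)
  ... | inj₁ 0≤x⁻¹ = 0≤x⁻¹
  ... | inj₂ x⁻¹≤0 = ⊥-elim (1≰0 (subst₂ _≤_ (*-inverseʳ x (0≢x ∘ sym)) (trans (*-comm x 0#) (zeroˡ x))
                       (*-monoˡ-≤ x 0≤x x⁻¹≤0)))

  0≤fromℕ : ∀ n → 0# ≤ fromℕ n
  0≤fromℕ zero    = ≤-refl
  0≤fromℕ (suc n) = ≤-trans 0≤1 (x≤x+y 1# (0≤fromℕ n))

  fromℕ-mono-≤ : ∀ {m n} → m ℕ.≤ n → fromℕ m ≤ fromℕ n
  fromℕ-mono-≤ {n = n} ℕ.z≤n = 0≤fromℕ n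
  fromℕ-mono-≤ (ℕ.s≤s m≤n)   = +-monoʳ-≤ 1# (fromℕ-mono-≤ m≤n)

  fromℕ-cancel-≤ : ∀ {m n} → fromℕ m ≤ fromℕ n → m ℕ.≤ n
  fromℕ-cancel-≤ {m} {n} le with m ℕ.≤? n
  ... | yes m≤n = m≤n
  ... | no  m≰n = ⊥-elim (1+x≰x (fromℕ n) (≤-trans (fromℕ-mono-≤ (ℕ.≰⇒> m≰n)) le))

  fromℕ≡×1 : ∀ n → fromℕ n ≡ n ×ℕ 1#
  fromℕ≡×1 zero    = refl
  fromℕ≡×1 (suc n) = cong (1# +_) (fromℕ≡×1 n)

  fromℕ-+ : ∀ m n → fromℕ (m ℕ.+ n) ≡ fromℕ m + fromℕ n
  fromℕ-+ m n = trans (fromℕ≡×1 (m ℕ.+ n)) (trans (×-homo-+ 1# m n)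
    (sym (cong₂ _+_ (fromℕ≡×1 m) (fromℕ≡×1 n))))

  fromℕ-* : ∀ m n → fromℕ (m ℕ.* n) ≡ fromℕ m * fromℕ n
  fromℕ-* m n = trans (fromℕ≡×1 (m ℕ.* n)) (trans (×1-homo-* m n)
    (sym (cong₂ _*_ (fromℕ≡×1 m) (fromℕ≡×1 n))))

  fromℕ2* : ∀ x → fromℕ 2 * x ≡ x + x
  fromℕ2* x = trans (cong (_* x) (cong (1# +_) (+-identityʳ 1#)))
    (trans (distribʳ x 1# 1#) (cong₂ _+_ (*-identityˡ x) (*-identityˡ x)))

  module _ (em : ExcludedMiddle 0ℓ) where

    -- Were the naturals bounded, they would have a supremum `s`; since `1# + fromℕ n ≤ s` for every
    -- `n`, `s - 1#` would be a smaller upper bound.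
    archimedean : ∀ x → ∃ λ n → x ≤ fromℕ n
    archimedean x with em {∃ λ n → x ≤ fromℕ n}
    ... | yes p = p
    ... | no ¬p = ⊥-elim (1+x≰x s (subst₂ _≤_ (+-comm s 1#) ([x-y]+y≡x s 1#)
                    (+-monoˡ-≤ 1# (least (s - 1#) s-1-ub))))
      where
      IsNatural : Carrier → Set
      IsNatural u = ∃ λ n → u ≡ fromℕ n
      x-ub : IsUpperBound IsNatural x
      x-ub _ (n , refl) with total (fromℕ n) x
      ... | inj₁ n≤x = n≤x
      ... | inj₂ x≤n = contradiction (n , x≤n) ¬p
      sup : Σ[ s ∈ Carrier ] IsUpperBound IsNatural s × (∀ u → IsUpperBound IsNatural u → s ≤ u)
      sup = supremum IsNatural (0# , 0 , refl) (x , x-ub)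
      s : Carrier
      s = proj₁ sup
      least : ∀ u → IsUpperBound IsNatural u → s ≤ u
      least = proj₂ (proj₂ sup)
      s-1-ub : IsUpperBound IsNatural (s - 1#)
      s-1-ub _ (n , refl) = +-cancelʳ-≤ 1# (subst₂ _≤_ (+-comm 1# (fromℕ n)) (sym ([x-y]+y≡x s 1#))
        (proj₁ (proj₂ sup) (fromℕ (suc n)) (suc n , refl)))

    open Search R using (IsCeiling)

    -- Descends from an Archimedean bound until the next natural number down would lie below `x`;
    -- `0# ≤ x` settles a descent that reaches 0.
    ceiling : ∀ x → 0# ≤ x → ∃ (IsCeiling x)
    ceiling x 0≤x = let m , x≤m = archimedean x in search m x≤m
      where
      search : ∀ m → x ≤ fromℕ m → ∃ (IsCeiling x)
      search zero    x≤0 = 0 , x≤0 , ≤-trans 0≤x (x≤x+y x 0≤1) ,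
        λ 0≡x+1 → 1≰0 (subst₂ _≤_ (+-identityˡ 1#) (sym 0≡x+1) (+-monoˡ-≤ 1# 0≤x))
      search (suc m) x≤1+m with em {x ≤ fromℕ m}
      ... | yes x≤m = search m x≤m
      ... | no  x≰m = suc m , x≤1+m , subst (fromℕ (suc m) ≤_) (+-comm 1# x) (+-monoʳ-≤ 1# m≤x) ,
        λ 1+m≡x+1 → x≰m (+-cancelʳ-≤ 1# (≤-reflexive (sym (trans (+-comm (fromℕ m) 1#) 1+m≡x+1))))
        where
        m≤x : fromℕ m ≤ x
        m≤x with total (fromℕ m) x
        ... | inj₁ m≤x = m≤x
        ... | inj₂ x≤m = contradiction x≤m x≰m

  module _ {β : Carrier} (0<β : 0# < β) where

    0≤fromℕ/ : ∀ f → 0# ≤ fromℕ f / β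
    0≤fromℕ/ f = *-nonNegative (0≤fromℕ f) (0<x⇒0≤x⁻¹ 0<β)

    -- Clears the denominators: the summand 2 becomes the 6, the slack that `search-time-2d` spends
    -- on rounding the group size and on a strict inequality.
    density-bound : β ≤ fromℕ 3 / fromℕ 10 → ∀ f n → fromℕ f / β + fromℕ 2 ≤ fromℕ n →
                    10 ℕ.* f ℕ.+ 6 ℕ.≤ 3 ℕ.* n
    density-bound β≤3/10 f n x+2≤n = fromℕ-cancel-≤ (begin
      fromℕ (10 ℕ.* f ℕ.+ 6)            ≡⟨ fromℕ-+ (10 ℕ.* f) 6 ⟩
      fromℕ (10 ℕ.* f) + fromℕ 6        ≡⟨ cong (_+ fromℕ 6) (fromℕ-* 10 f) ⟩
      fromℕ 10 * fromℕ f + fromℕ 6      ≡⟨ cong (λ y → fromℕ 10 * y + fromℕ 6) f≡xβ ⟩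
      fromℕ 10 * (x * β) + fromℕ 6      ≡⟨ cong (_+ fromℕ 6) (swap (fromℕ 10) x β) ⟩
      x * (fromℕ 10 * β) + fromℕ 6      ≤⟨ +-monoˡ-≤ (fromℕ 6) (*-monoˡ-≤ x (0≤fromℕ/ f) 10β≤3) ⟩
      x * fromℕ 3 + fromℕ 6             ≡⟨ cong₂ _+_ (*-comm x (fromℕ 3)) (fromℕ-* 3 2) ⟩
      fromℕ 3 * x + fromℕ 3 * fromℕ 2   ≡⟨ distribˡ (fromℕ 3) x (fromℕ 2) ⟨
      fromℕ 3 * (x + fromℕ 2)           ≤⟨ *-monoˡ-≤ (fromℕ 3) (0≤fromℕ 3) x+2≤n ⟩
      fromℕ 3 * fromℕ n                 ≡⟨ fromℕ-* 3 n ⟨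
      fromℕ (3 ℕ.* n)                   ∎)
      where
      open Solver
      swap : ∀ x y z → x * (y * z) ≡ y * (x * z)
      swap = solve 3 (λ x y z → x :* (y :* z) := y :* (x :* z)) refl
      x : Carrier
      x = fromℕ f / β
      f≡xβ : fromℕ f ≡ x * β
      f≡xβ = sym (trans (*-assoc (fromℕ f) (β ⁻¹) β)
        (trans (cong (fromℕ f *_) (trans (*-comm (β ⁻¹) β) (*-inverseʳ β (proj₂ 0<β ∘ sym))))
          (*-identityʳ (fromℕ f))))
      10≢0 : fromℕ 10 ≢ 0#
      10≢0 eq = contradiction (fromℕ-cancel-≤ {10} {0} (≤-reflexive eq)) (ℕ.<⇒≱ (ℕ.s≤s ℕ.z≤n))
      10β≤3 : fromℕ 10 * β ≤ fromℕ 3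
      10β≤3 = begin
        fromℕ 10 * β                     ≤⟨ *-monoˡ-≤ (fromℕ 10) (0≤fromℕ 10) β≤3/10 ⟩
        fromℕ 10 * (fromℕ 3 / fromℕ 10)  ≡⟨ swap (fromℕ 10) (fromℕ 3) (fromℕ 10 ⁻¹) ⟩
        fromℕ 3 * (fromℕ 10 / fromℕ 10)  ≡⟨ cong (fromℕ 3 *_) (*-inverseʳ (fromℕ 10) 10≢0) ⟩
        fromℕ 3 * 1#                     ≡⟨ *-identityʳ (fromℕ 3) ⟩
        fromℕ 3                          ∎

-- Votes of the running groups and conflicts.

data Direction : Set where
  leftward rightward : Direction

opposite : Direction → Direction
opposite leftward  = rightward
opposite rightward = leftward

module Strategy (em : ExcludedMiddle 0ℓ) (R : CompleteOrderedField) (f a : ℕ) {n : ℕ}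
                (group : Direction → Subset n)
                (disjoint : ∀ σ → group (opposite σ) ⊆ ∁ (group σ)) where

  open CompleteOrderedField R renaming (Carrier to ℝ)
  open OrderedField R
  open Search R
  open ≤-Reasoning

  signed : Direction → ℝ → ℝ
  signed leftward  x = - x
  signed rightward x = x

  signed-injective : ∀ σ {x y} → signed σ x ≡ signed σ y → x ≡ y
  signed-injective leftward  = neg-injective
  signed-injective rightward eq = eq

  -- Takes the messages of one instant, so that logs equal at that instant have equal claimants.
  -- Equality of real positions is decided by `em`.
  claimants : Direction → (Fin n → Maybe ℝ) → ℝ → Subset n
  claimants σ messages x = comprehension (λ i → em {messages i ≡ just (signed σ x)}) ∩ group σ

  ∈-claimants⁺ : ∀ σ {messages x i} → messages i ≡ just (signed σ x) → i ∈ group σ →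
                 i ∈ claimants σ messages x
  ∈-claimants⁺ σ eq i∈σ = x∈p∩q⁺ (∈-comprehension⁺ (λ _ → em) eq , i∈σ)

  ∈-claimants⁻ : ∀ σ {messages x i} → i ∈ claimants σ messages x →
                 messages i ≡ just (signed σ x) × i ∈ group σ
  ∈-claimants⁻ σ i∈ = let i∈c , i∈σ = x∈p∩q⁻ _ (group σ) i∈ in
    ∈-comprehension⁻ (λ _ → em) i∈c , i∈σ

  claimants-⊆ : ∀ σ {messages messages′ x} → (∀ i → messages i ≡ messages′ i) →
                claimants σ messages x ⊆ claimants σ messages′ x
  claimants-⊆ σ eq {i} i∈ = let eqᵢ , i∈σ = ∈-claimants⁻ σ i∈ in
    ∈-claimants⁺ σ (trans (sym (eq i)) eqᵢ) i∈σ

  -- A running group is at distance t from the origin at time t.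
  Conflict : Direction → Log n → ℝ → Set
  Conflict σ L t = a ℕ.≤ ∣ claimants σ (L t) t ∣ ℕ.+ f × ∣ claimants σ (L t) t ∣ ℕ.≤ f

  Conflict-cong : ∀ σ {L L′ t} → (∀ i → L t i ≡ L′ t i) → Conflict σ L t → Conflict σ L′ t
  Conflict-cong σ eq = subst (λ c → a ℕ.≤ ∣ c ∣ ℕ.+ f × ∣ c ∣ ℕ.≤ f)
    (⊆-antisym (claimants-⊆ σ eq) (claimants-⊆ σ (λ i → sym (eq i))))

  -- Time elapsed since the first conflict.

  -- The alternative `u ≡ 0#` keeps the set nonempty and makes the supremum 0 when there is no
  -- conflict. The bound `s < t` is strict because causality lets a position at `t` depend on
  -- earlier messages only.
  Elapsed : Direction → Log n → ℝ → ℝ → Set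
  Elapsed σ L t u =
    u ≡ 0# ⊎ (Σ[ s ∈ ℝ ] 0# ≤ s × s < t × Conflict σ L s × u + s ≡ t)

  Elapsed-bounded : ∀ σ L t → ∃ (IsUpperBound (Elapsed σ L t))
  Elapsed-bounded σ L t with total 0# t
  ... | inj₁ 0≤t = t , λ where
    _ (inj₁ refl)                      → 0≤t
    u (inj₂ (s , 0≤s , _ , _ , u+s≡t)) → subst (u ≤_) u+s≡t (x≤x+y u 0≤s)
  -- The supremum needs a bound at negative `t` as well, because `since` is total.
  ... | inj₂ t≤0 = 0# , λ where
    _ (inj₁ refl)                      → ≤-refl
    u (inj₂ (s , 0≤s , _ , _ , u+s≡t)) → ≤-trans (subst (u ≤_) u+s≡t (x≤x+y u 0≤s)) t≤0

  -- The adversary may produce conflicts at times without a least element, so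
  -- the time since the first conflict is defined as a supremum (0 if none).
  since-sup : ∀ σ L t → Σ[ s ∈ ℝ ] IsUpperBound (Elapsed σ L t) s ×
                                   (∀ u → IsUpperBound (Elapsed σ L t) u → s ≤ u)
  since-sup σ L t = supremum (Elapsed σ L t) (0# , inj₁ refl) (Elapsed-bounded σ L t)

  since : Direction → Log n → ℝ → ℝ
  since σ L t = proj₁ (since-sup σ L t)

  0≤since : ∀ σ L t → 0# ≤ since σ L t
  0≤since σ L t = proj₁ (proj₂ (since-sup σ L t)) 0# (inj₁ refl)

  -- This and `since-least` are the two halves of the supremum property with the subtraction moved
  -- across. With `0≤since` they are all that later arguments use about it.
  conflict⇒≤since : ∀ {σ L s t} → 0# ≤ s → s < t → Conflict σ L s → t ≤ since σ L t + s
  conflict⇒≤since {σ} {L} {s} {t} 0≤s s<t conflict = subst (_≤ since σ L t + s) ([x-y]+y≡x t s)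
    (+-monoˡ-≤ s (proj₁ (proj₂ (since-sup σ L t)) (t - s)
      (inj₂ (s , 0≤s , s<t , conflict , [x-y]+y≡x t s))))

  since-least : ∀ {σ L t u} → 0# ≤ u → (∀ s → 0# ≤ s → s < t → Conflict σ L s → t ≤ u + s) →
                since σ L t ≤ u
  since-least {σ} {L} {t} {u} 0≤u bound = proj₂ (proj₂ (since-sup σ L t)) u λ where
    _ (inj₁ refl)                               → 0≤u
    v (inj₂ (s , 0≤s , s<t , conflict , v+s≡t)) →
      +-cancelʳ-≤ s (subst (_≤ u + s) (sym v+s≡t) (bound s 0≤s s<t conflict))

  since≤ : ∀ σ L {t} → 0# ≤ t → since σ L t ≤ t
  since≤ σ L {t} 0≤t = since-least 0≤t λ s 0≤s _ _ → x≤x+y t 0≤s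

  since-zero : ∀ {σ L t} → (∀ s → 0# ≤ s → s < t → ¬ Conflict σ L s) → since σ L t ≡ 0#
  since-zero {σ} {L} {t} none = ≤-antisym
    (since-least ≤-refl λ s 0≤s s<t conflict → contradiction conflict (none s 0≤s s<t))
    (0≤since σ L t)

  -- Only conflicts strictly before `t` enter, which is what makes the algorithm causal.
  since-cong-≤ : ∀ σ {L L′ t} → AgreeBefore t L L′ → since σ L t ≤ since σ L′ t
  since-cong-≤ σ {L} {L′} {t} agree = since-least (0≤since σ L′ t) λ s 0≤s s<t conflict →
    conflict⇒≤since 0≤s s<t (Conflict-cong σ {L} {L′} (λ i → agree s i 0≤s s<t) conflict)

  since-cong : ∀ σ {L L′ t} → AgreeBefore t L L′ → since σ L t ≡ since σ L′ t
  since-cong σ agree = ≤-antisym (since-cong-≤ σ agree)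
    (since-cong-≤ σ λ s i 0≤s s<t → sym (agree s i 0≤s s<t))

  since-mono : ∀ σ L t {h} → 0# ≤ h → since σ L t ≤ since σ L (t + h)
  since-mono σ L t {h} 0≤h = since-least (0≤since σ L (t + h)) λ s 0≤s s<t conflict →
    +-cancelʳ-≤ h (begin
      t + h                        ≤⟨ conflict⇒≤since 0≤s (<-≤-trans s<t (x≤x+y t 0≤h)) conflict ⟩
      since σ L (t + h) + s        ≤⟨ x≤x+y _ 0≤h ⟩
      since σ L (t + h) + s + h    ∎)

  -- For a conflict before `t` the elapsed time grows by exactly `h`; one at `t` or later
  -- contributes at most `h`. With `since-mono`, this yields the speed limit of the waiting robots.
  since-lipschitz : ∀ σ L t {h} → 0# ≤ h → since σ L (t + h) ≤ since σ L t + h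
  since-lipschitz σ L t {h} 0≤h = since-least (≤-trans (0≤since σ L t) (x≤x+y _ 0≤h)) bound
    where
    bound : ∀ s → 0# ≤ s → s < t + h → Conflict σ L s → t + h ≤ since σ L t + h + s
    bound s 0≤s _ conflict with em {s < t}
    ... | yes s<t = begin
      t + h                ≤⟨ +-monoˡ-≤ h (conflict⇒≤since 0≤s s<t conflict) ⟩
      since σ L t + s + h  ≡⟨ x+y+z≡x+z+y (since σ L t) s h ⟩
      since σ L t + h + s  ∎
    ... | no s≮t = begin
      t + h                ≤⟨ +-monoˡ-≤ h t≤s ⟩
      s + h                ≡⟨ cong (_+ h) (+-identityˡ s) ⟨
      0# + s + h           ≤⟨ +-monoˡ-≤ h (+-monoˡ-≤ s (0≤since σ L t)) ⟩
      since σ L t + s + h  ≡⟨ x+y+z≡x+z+y (since σ L t) s h ⟩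
      since σ L t + h + s  ∎
      where
      t≤s : t ≤ s
      t≤s with total t s
      ... | inj₁ t≤s = t≤s
      ... | inj₂ s≤t = ≤-reflexive (sym (decidable-stable em λ s≢t → s≮t (s≤t , s≢t)))

  -- Replaces an intermediate value theorem: where it is positive, the elapsed time grows at rate
  -- exactly 1, so going back from `u` by the excess `D - d` leads to a time at which it equals `d`.
  since-hits : ∀ σ L {d u} → 0# ≤ d → 0# ≤ u → d ≤ since σ L u →
               Σ[ t ∈ ℝ ] 0# ≤ t × t ≤ u × since σ L t ≡ d
  since-hits σ L {d} {u} 0≤d 0≤u d≤D = t , 0≤t , t≤u , ≤-antisym since≤d d≤since
    where
    D e t : ℝ
    D = since σ L u
    e = D - d
    t = u - e
    0≤e : 0# ≤ e
    0≤e = x≤y⇒0≤y-x d≤D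
    t+e≡u : t + e ≡ u
    t+e≡u = [x-y]+y≡x u e
    d+e≡D : d + e ≡ D
    d+e≡D = trans (+-comm d e) ([x-y]+y≡x D d)
    t≤u : t ≤ u
    t≤u = subst (t ≤_) t+e≡u (x≤x+y t 0≤e)
    0≤t : 0# ≤ t
    -- Here `e ≤ D ≤ u`, as no conflict precedes time 0.
    0≤t = x≤y⇒0≤y-x (≤-trans (subst (e ≤_) (trans (+-comm e d) d+e≡D) (x≤x+y e 0≤d)) (since≤ σ L 0≤u))
    d≤since : d ≤ since σ L t
    d≤since = +-cancelʳ-≤ e (begin
      d + e              ≡⟨ d+e≡D ⟩
      since σ L u        ≡⟨ cong (since σ L) t+e≡u ⟨
      since σ L (t + e)  ≤⟨ since-lipschitz σ L t 0≤e ⟩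
      since σ L t + e    ∎)
    since≤d : since σ L t ≤ d
    since≤d = since-least 0≤d λ s 0≤s s<t conflict → +-cancelʳ-≤ e (begin
      t + e      ≡⟨ t+e≡u ⟩
      u          ≤⟨ conflict⇒≤since 0≤s (<-≤-trans s<t t≤u) conflict ⟩
      D + s      ≡⟨ cong (_+ s) d+e≡D ⟨
      d + e + s  ≡⟨ x+y+z≡x+z+y d e s ⟩
      d + s + e  ∎)

  -- Trajectories and the algorithm.

  -- Speed is bounded per step of length `h`, without subtraction, to match the form of `since-mono`
  -- and `since-lipschitz`.
  isTrajectory-by-steps : ∀ {p} → p 0# ≡ 0# →
    (∀ t {h} → 0# ≤ h → p (t + h) ≤ p t + h × p t ≤ p (t + h) + h) → IsTrajectory p
  isTrajectory-by-steps {p} start steps = record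
    { start = start
    ; speed = λ s t _ s≤t →
        let up , down = steps s (x≤y⇒0≤y-x s≤t)
            s+h≡t     = trans (+-comm s (t - s)) ([x-y]+y≡x t s)
        in x≤y+z⇒x-z≤y (p s) (subst₂ _≤_ (cong p s+h≡t) (+-comm (p s) (t - s)) up) ,
           x≤y+z⇒x-z≤y (p t) (subst (p s ≤_)
             (trans (cong (λ r → p r + (t - s)) s+h≡t) (+-comm (p t) (t - s))) down)
    }

  -- Once both sides have had a conflict, the two terms move in parallel and the
  -- waiting robots stand still.
  waiting : Log n → ℝ → ℝ
  waiting L t = since rightward L t - since leftward L t

  -- With no conflict counted on the other side, one term of the difference vanishes.
  waiting-arrives : ∀ σ L {t} → since (opposite σ) L t ≡ 0# → waiting L t ≡ signed σ (since σ L t)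
  waiting-arrives leftward  L {t} eq = trans (cong (_- since leftward L t) eq) (+-identityˡ _)
  waiting-arrives rightward L {t} eq =
    trans (cong (λ x → since rightward L t - x) eq)
      (trans (cong (since rightward L t +_) -0≡0) (+-identityʳ _))

  -- Each bound takes the growth rate from one of the two terms and monotonicity from the other;
  -- hence the speed limit is 1 rather than 2.
  waiting-steps : ∀ L t {h} → 0# ≤ h →
                  waiting L (t + h) ≤ waiting L t + h × waiting L t ≤ waiting L (t + h) + h
  waiting-steps L t {h} 0≤h = (begin
      r′ - l′       ≤⟨ +-mono-≤ (since-lipschitz rightward L t 0≤h) (neg-mono-≤ (since-mono leftward L t 0≤h)) ⟩
      r + h + - l   ≡⟨ x+y+z≡x+z+y r h (- l) ⟩
      r - l + h     ∎) , (begin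
      r - l              ≤⟨ +-monoˡ-≤ (- l) (since-mono rightward L t 0≤h) ⟩
      r′ - l             ≡⟨ cong (r′ +_) ([x-y]+y≡x (- l) h) ⟨
      r′ + (- l - h + h) ≡⟨ cong (λ x → r′ + (x + h)) (-‿+-comm l h) ⟩
      r′ + (- (l + h) + h) ≤⟨ +-monoʳ-≤ r′ (+-monoˡ-≤ h (neg-mono-≤ (since-lipschitz leftward L t 0≤h))) ⟩
      r′ + (- l′ + h)    ≡⟨ +-assoc r′ (- l′) h ⟨
      r′ - l′ + h        ∎)
    where
    r l r′ l′ : ℝ
    r  = since rightward L t
    l  = since leftward L t
    r′ = since rightward L (t + h)
    l′ = since leftward L (t + h)

  running-steps : ∀ σ t {h} → 0# ≤ h →
                  signed σ (t + h) ≤ signed σ t + h × signed σ t ≤ signed σ (t + h) + h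
  running-steps rightward t 0≤h = ≤-refl , ≤-trans (x≤x+y t 0≤h) (x≤x+y _ 0≤h)
  running-steps leftward t {h} 0≤h =
    ≤-trans (neg-mono-≤ (x≤x+y t 0≤h)) (x≤x+y _ 0≤h) ,
    ≤-reflexive (sym (trans (cong (_+ h) (sym (-‿+-comm t h))) ([x-y]+y≡x (- t) h)))

  -- Takes the membership decisions as arguments so that proofs about a single robot can split on
  -- them.
  route : ∀ {P Q : Set} → Dec P → Dec Q → Log n → ℝ → ℝ
  route (yes _) _       L t = signed rightward t
  route (no _)  (yes _) L t = signed leftward t
  route (no _)  (no _)  L t = waiting L t

  route-isTrajectory : ∀ {P Q} (P? : Dec P) (Q? : Dec Q) L → IsTrajectory (route P? Q? L)
  route-isTrajectory (yes _) _       L = isTrajectory-by-steps refl (running-steps rightward)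
  route-isTrajectory (no _)  (yes _) L = isTrajectory-by-steps -0≡0 (running-steps leftward)
  route-isTrajectory (no _)  (no _)  L = isTrajectory-by-steps
    (trans (cong₂ _-_ (at-start rightward) (at-start leftward)) (-‿inverseʳ 0#)) (waiting-steps L)
    where
    at-start : ∀ σ → since σ L 0# ≡ 0#
    at-start σ = since-zero λ { s 0≤s (s≤0 , s≢0) → contradiction (≤-antisym s≤0 0≤s) s≢0 }

  route-causal : ∀ {P Q} (P? : Dec P) (Q? : Dec Q) {L L′ t} → AgreeBefore t L L′ →
                 route P? Q? L t ≡ route P? Q? L′ t
  route-causal (yes _) _       agree = refl
  route-causal (no _)  (yes _) agree = refl
  route-causal (no _)  (no _)  agree = cong₂ _-_ (since-cong rightward agree) (since-cong leftward agree)

  algorithm : Algorithm n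
  algorithm = record
    { position     = λ L i → route (i ∈? group rightward) (i ∈? group leftward) L
    ; isTrajectory = λ L i → route-isTrajectory (i ∈? group rightward) (i ∈? group leftward) L
    ; causal       = λ _ _ _ _ agree i → route-causal (i ∈? group rightward) (i ∈? group leftward) agree
    }

  open Algorithm algorithm using (position)

  position-running : ∀ σ {i} → i ∈ group σ → ∀ L t → position L i t ≡ signed σ t
  position-running rightward {i} i∈ L t with i ∈? group rightward
  ... | yes _ = refl
  ... | no i∉ = contradiction i∈ i∉
  position-running leftward {i} i∈ L t with i ∈? group rightward | i ∈? group leftward
  -- `route` tests for the rightward group first, so disjointness is what excludes this case.
  ... | yes i∈r | _     = contradiction i∈ (x∈∁p⇒x∉p (disjoint leftward i∈r))
  ... | no _    | yes _ = refl
  ... | no _    | no i∉ = contradiction i∈ i∉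

  position-waiting : ∀ {i} → (∀ σ → i ∉ group σ) → ∀ L t → position L i t ≡ waiting L t
  position-waiting {i} i∉ L t with i ∈? group rightward | i ∈? group leftward
  ... | yes i∈r | _       = contradiction i∈r (i∉ rightward)
  ... | no _    | yes i∈l = contradiction i∈l (i∉ leftward)
  ... | no _    | no _    = refl

  -- What the messages reveal about the faulty robots.

  module _ (E : Execution algorithm f) where
    open Execution E

    visitor-announces : ∀ {i t} → i ∉ faulty → 0# ≤ t → position log i t ≡ target →
                        Σ[ s ∈ ℝ ] 0# ≤ s × s ≤ t × log s i ≡ just target
    visitor-announces {i} {t} i∉F 0≤t at = reports i i∉F t 0≤t (trans (follows i i∉F t 0≤t) at)

    -- A runner passes each point of its ray only once, so the time at which it announces the target
    -- can only be `x`.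
    runner-claims : ∀ σ {i x} → i ∈ group σ → i ∉ faulty → 0# ≤ x → target ≡ signed σ x →
                    log x i ≡ just (signed σ x)
    runner-claims σ {i} {x} i∈σ i∉F 0≤x target≡ =
      let s , 0≤s , _ , log≡ = visitor-announces i∉F 0≤x (trans (position-running σ i∈σ log x) (sym target≡))
          s≡x = signed-injective σ (trans (sym (position-running σ i∈σ log s))
                  (trans (sym (follows i i∉F s 0≤s)) (trans (sym (located i s target 0≤s log≡)) target≡)))
      in subst₂ (λ r y → log r i ≡ just y) s≡x target≡ log≡

    group⊆claimants∪faulty : ∀ σ {x} → 0# ≤ x → target ≡ signed σ x →
                             group σ ⊆ claimants σ (log x) x ∪ (faulty ∩ group σ)
    group⊆claimants∪faulty σ 0≤x target≡ {i} i∈σ with i ∈? faulty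
    ... | yes i∈F = x∈p∪q⁺ (inj₂ (x∈p∩q⁺ (i∈F , i∈σ)))
    ... | no  i∉F = x∈p∪q⁺ (inj₁ (∈-claimants⁺ σ (runner-claims σ i∈σ i∉F 0≤x target≡) i∈σ))

    false-claimants-faulty : ∀ σ {x} → 0# ≤ x → target ≢ signed σ x →
                             claimants σ (log x) x ⊆ faulty ∩ group σ
    false-claimants-faulty σ {x} 0≤x target≢ {i} i∈ with ∈-claimants⁻ σ {log x} i∈ | i ∈? faulty
    ... | log≡ , i∈σ | yes i∈F = x∈p∩q⁺ (i∈F , i∈σ)
    ... | log≡ , i∈σ | no  i∉F = contradiction (sym (truthful i i∉F x _ 0≤x log≡)) target≢

    -- If the target is at the voted point, the silent members are faulty, and `c≤f` leaves at least
    -- `a - f` of them. Otherwise the claimants are faulty, and they number at least `a - f`. Adding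
    -- `f` on the right avoids truncated subtraction.
    conflict⇒faulty : ∀ σ {x} → ∣ group σ ∣ ≡ a → 0# ≤ x → Conflict σ log x →
                      a ℕ.≤ ∣ faulty ∩ group σ ∣ ℕ.+ f
    conflict⇒faulty σ {x} size 0≤x (a≤c+f , c≤f) with em {target ≡ signed σ x}
    ... | yes target≡ = ℕ≤.begin
      a                                                        ℕ≤.≡⟨ sym size ⟩
      ∣ group σ ∣                                              ℕ≤.≤⟨ p⊆q⇒∣p∣≤∣q∣ (group⊆claimants∪faulty σ 0≤x target≡) ⟩
      ∣ claimants σ (log x) x ∪ (faulty ∩ group σ) ∣           ℕ≤.≤⟨ ∣p∪q∣≤∣p∣+∣q∣ (claimants σ (log x) x) _ ⟩
      ∣ claimants σ (log x) x ∣ ℕ.+ ∣ faulty ∩ group σ ∣       ℕ≤.≤⟨ ℕ.+-monoˡ-≤ _ c≤f ⟩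
      f ℕ.+ ∣ faulty ∩ group σ ∣                               ℕ≤.≡⟨ ℕ.+-comm f _ ⟩
      ∣ faulty ∩ group σ ∣ ℕ.+ f                               ℕ≤.∎
      where module ℕ≤ = ℕ.≤-Reasoning
    ... | no target≢ = ℕ.≤-trans a≤c+f (ℕ.+-monoˡ-≤ f (p⊆q⇒∣p∣≤∣q∣ (false-claimants-faulty σ 0≤x target≢)))

  -- Certainty by time 2d: refuting a second scenario with the same messages.

  module Correctness (size : ∀ σ → ∣ group σ ∣ ≡ a) (4f<3a : 4 ℕ.* f ℕ.< 3 ℕ.* a)
                     (2f+a<n : f ℕ.+ f ℕ.+ a ℕ.< n) where

    f<a : f ℕ.< a
    f<a = ℕ.*-cancelˡ-< 3 f a (ℕ.≤-<-trans (ℕ.*-monoˡ-≤ f {3} {4} (ℕ.n≤1+n 3)) 4f<3a)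

    module _ (E E′ : Execution algorithm f) (u : ℝ)
             (agree : AgreeUpTo u (Execution.log E) (Execution.log E′))
             (differ : Execution.target E′ ≢ Execution.target E) where
      open Execution E
      open Execution E′ using () renaming (faulty to faulty′; log to log′; truthful to truthful′)

      -- A visitor reliable in both scenarios would announce the target of `E`, and by `agree` the
      -- same announcement would occur in `E′`, where it is false.
      visitors⊆faulty∪faulty′ : ∀ {V : Subset n} →
        (∀ {i} → i ∈ V → Σ[ t ∈ ℝ ] 0# ≤ t × t ≤ u × position log i t ≡ target) →
        V ⊆ faulty ∪ faulty′
      visitors⊆faulty∪faulty′ visit {i} i∈V with i ∈? faulty | i ∈? faulty′
      ... | yes i∈F | _        = x∈p∪q⁺ (inj₁ i∈F)
      ... | no _    | yes i∈F′ = x∈p∪q⁺ (inj₂ i∈F′)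
      ... | no i∉F  | no i∉F′  =
        let t , 0≤t , t≤u , at = visit i∈V
            s , 0≤s , s≤t , log≡ = visitor-announces E i∉F 0≤t at
        in contradiction
             (sym (truthful′ i i∉F′ s target 0≤s (trans (sym (agree s i 0≤s (≤-trans s≤t t≤u))) log≡)))
             differ

      -- `E` allows at most `f` silent runners at its target, and `E′`, whose target is elsewhere,
      -- allows at most `f` claimants there. Together these bounds are a conflict.
      no-conflict⇒⊥ : ∀ σ {d} → 0# ≤ d → d ≤ u → target ≡ signed σ d → ¬ Conflict σ log d → ⊥
      no-conflict⇒⊥ σ {d} 0≤d d≤u target≡ no-conflict = no-conflict (a≤c+f , c≤f)
        where
        C : Subset n
        C = claimants σ (log d) d
        a≤c+f : a ℕ.≤ ∣ C ∣ ℕ.+ f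
        a≤c+f = ℕ.≤-trans (ℕ.≤-reflexive (sym (size σ)))
          (ℕ.≤-trans (p⊆q⇒∣p∣≤∣q∣ (group⊆claimants∪faulty E σ 0≤d target≡))
          (ℕ.≤-trans (∣p∪q∣≤∣p∣+∣q∣ C (faulty ∩ group σ))
          (ℕ.+-monoʳ-≤ ∣ C ∣ (ℕ.≤-trans (∣p∩q∣≤∣p∣ faulty (group σ)) ∣faulty∣))))
        c≤f : ∣ C ∣ ℕ.≤ f
        c≤f = ℕ.≤-trans (p⊆q⇒∣p∣≤∣q∣ (⊆-trans (claimants-⊆ σ (λ i → agree d i 0≤d d≤u))
          (false-claimants-faulty E′ σ 0≤d (λ eq → differ (trans eq (sym target≡))))))
          (ℕ.≤-trans (∣p∩q∣≤∣p∣ faulty′ (group σ)) (Execution.∣faulty∣ E′))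

      -- All of group `σ` visits the target, so `a ≤ p + p′`. The conflict occurs in both scenarios,
      -- so `a ≤ q + f` and `a ≤ q′ + f`. As `p + q ≤ f` and `p′ + q′ ≤ f`, the sum gives `3a ≤ 4f`.
      opposite-conflict⇒⊥ : ∀ σ {d s} → 0# ≤ d → d ≤ u → target ≡ signed σ d →
                            0# ≤ s → s ≤ u → Conflict (opposite σ) log s → ⊥
      opposite-conflict⇒⊥ σ {d} {s} 0≤d d≤u target≡ 0≤s s≤u conflict = ℕ.<⇒≱ 4f<3a 3a≤4f
        where
        τ : Direction
        τ = opposite σ
        conflict′ : Conflict τ log′ s
        conflict′ = Conflict-cong τ {log} {log′} (λ i → agree s i 0≤s s≤u) conflict
        p q p′ q′ : ℕ
        p  = ∣ faulty ∩ group σ ∣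
        q  = ∣ faulty ∩ group τ ∣
        p′ = ∣ faulty′ ∩ group σ ∣
        q′ = ∣ faulty′ ∩ group τ ∣
        group⊆ : group σ ⊆ (faulty ∩ group σ) ∪ (faulty′ ∩ group σ)
        group⊆ i∈σ with x∈p∪q⁻ faulty faulty′
          (visitors⊆faulty∪faulty′
            (λ j∈σ → d , 0≤d , d≤u , trans (position-running σ j∈σ log d) (sym target≡)) i∈σ)
        ... | inj₁ i∈F  = x∈p∪q⁺ (inj₁ (x∈p∩q⁺ (i∈F , i∈σ)))
        ... | inj₂ i∈F′ = x∈p∪q⁺ (inj₂ (x∈p∩q⁺ (i∈F′ , i∈σ)))
        a≤p+p′ : a ℕ.≤ p ℕ.+ p′
        a≤p+p′ = ℕ.≤-trans (ℕ.≤-reflexive (sym (size σ)))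
          (ℕ.≤-trans (p⊆q⇒∣p∣≤∣q∣ group⊆) (∣p∪q∣≤∣p∣+∣q∣ (faulty ∩ group σ) _))
        p+q≤f : p ℕ.+ q ℕ.≤ f
        p+q≤f = ℕ.≤-trans (disjoint⇒∣p∩q∣+∣p∩r∣≤∣p∣ faulty (disjoint σ)) ∣faulty∣
        p′+q′≤f : p′ ℕ.+ q′ ℕ.≤ f
        p′+q′≤f = ℕ.≤-trans (disjoint⇒∣p∩q∣+∣p∩r∣≤∣p∣ faulty′ (disjoint σ)) (Execution.∣faulty∣ E′)
        open +-*-Solver
        3a≤4f : 3 ℕ.* a ℕ.≤ 4 ℕ.* f
        3a≤4f = ℕ.≤-trans
          (ℕ.+-mono-≤ a≤p+p′ (ℕ.+-mono-≤ (conflict⇒faulty E τ (size τ) 0≤s conflict)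
            -- The 0 comes from unfolding `3 * a` to `a + (a + (a + 0))`.
            (ℕ.+-monoˡ-≤ 0 (conflict⇒faulty E′ τ (size τ) 0≤s conflict′))))
          (ℕ.≤-trans (ℕ.≤-reflexive (solve 5 (λ p q p′ q′ f →
            p :+ p′ :+ (q :+ f :+ (q′ :+ f :+ con 0)) := (p :+ q) :+ (p′ :+ q′) :+ (f :+ f)) refl p q p′ q′ f))
          (ℕ.≤-trans (ℕ.+-monoˡ-≤ (f ℕ.+ f) (ℕ.+-mono-≤ p+q≤f p′+q′≤f))
          (ℕ.≤-reflexive (solve 1 (λ f → f :+ f :+ (f :+ f) := con 4 :* f) refl f))))

      -- More than `2f` robots lie outside the opposite group, but each of them is faulty in one of
      -- the two scenarios, which have at most `2f` faulty robots between them.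
      many-visitors⇒⊥ : ∀ σ → (∀ {i} → i ∉ group (opposite σ) →
                          Σ[ t ∈ ℝ ] 0# ≤ t × t ≤ u × position log i t ≡ target) → ⊥
      many-visitors⇒⊥ σ visit = ℕ.<⇒≱ (ℕ.m+n≤o⇒m≤o∸n (suc (f ℕ.+ f)) 2f+a<n) n∸a≤2f
        where
        τ : Direction
        τ = opposite σ
        n∸a≤2f : n ℕ.∸ a ℕ.≤ f ℕ.+ f
        n∸a≤2f = subst (ℕ._≤ f ℕ.+ f) (trans (∣∁p∣≡n∸∣p∣ (group τ)) (cong (n ℕ.∸_) (size τ)))
          (ℕ.≤-trans (p⊆q⇒∣p∣≤∣q∣ (visitors⊆faulty∪faulty′ (visit ∘ x∈∁p⇒x∉p)))
          (ℕ.≤-trans (∣p∪q∣≤∣p∣+∣q∣ faulty faulty′)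
          (ℕ.+-mono-≤ ∣faulty∣ (Execution.∣faulty∣ E′))))

    certain : ∀ σ (E : Execution algorithm f) {d} → 0# < d → Execution.target E ≡ signed σ d →
              Certain E (d + d)
    certain σ E {d} (0≤d , 0≢d) target≡ E′ agree = decidable-stable em refute
      where
      open Execution E using (target; log)
      d≤2d : d ≤ d + d
      d≤2d = x≤x+y d 0≤d
      -- Strictness lets the conflict at time `d` count towards the elapsed time at `d + d`; it
      -- rests on `0≢d`.
      d<2d : d < d + d
      d<2d = d≤2d , λ d≡2d → 0≢d (≤-antisym 0≤d (+-cancelʳ-≤ d (≤-reflexive
        (trans (sym d≡2d) (sym (+-identityˡ d))))))
      refute : ¬ (Execution.target E′ ≢ target)
      refute differ with em {Conflict σ log d}
                       -- Conflicts on the other side from `d + d` on come too late to divert the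
                       -- waiting robots.
                       | em {Σ[ s ∈ ℝ ] 0# ≤ s × s < d + d × Conflict (opposite σ) log s}
      ... | no none | _ = no-conflict⇒⊥ E E′ (d + d) agree differ σ 0≤d d≤2d target≡ none
      ... | yes _ | yes (s , 0≤s , (s≤2d , _) , conflict) =
        opposite-conflict⇒⊥ E E′ (d + d) agree differ σ 0≤d d≤2d target≡ 0≤s s≤2d conflict
      ... | yes conflict | no none = many-visitors⇒⊥ E E′ (d + d) agree differ σ visit
        where
        -- After a conflict at time `d` the elapsed time at `d + d` is at least `d`. The moment at
        -- which it equals `d` is when the waiting robots stand on the target.
        arrival : Σ[ t ∈ ℝ ] 0# ≤ t × t ≤ d + d × since σ log t ≡ d
        arrival = since-hits σ log 0≤d (≤-trans 0≤d d≤2d)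
          (+-cancelʳ-≤ d (conflict⇒≤since 0≤d d<2d conflict))
        visit : ∀ {i} → i ∉ group (opposite σ) → Σ[ t ∈ ℝ ] 0# ≤ t × t ≤ d + d × position log i t ≡ target
        visit {i} i∉τ with i ∈? group σ | arrival
        ... | yes i∈σ | _ = d , 0≤d , d≤2d , trans (position-running σ i∈σ log d) (sym target≡)
        ... | no i∉σ  | t , 0≤t , t≤2d , since≡d = t , 0≤t , t≤2d ,
          trans (position-waiting (outside-groups σ i∉σ i∉τ) log t)
            (trans (waiting-arrives σ log (since-zero λ s 0≤s s<t conflict′ →
                none (s , 0≤s , <-≤-trans s<t t≤2d , conflict′)))
              (trans (cong (signed σ) since≡d) (sym target≡)))
          where
          outside-groups : ∀ σ → i ∉ group σ → i ∉ group (opposite σ) → ∀ ρ → i ∉ group ρ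
          outside-groups leftward  i∉l i∉r leftward  = i∉l
          outside-groups leftward  i∉l i∉r rightward = i∉r
          outside-groups rightward i∉r i∉l leftward  = i∉l
          outside-groups rightward i∉r i∉l rightward = i∉r

    -- A group has more than `f` members, so one of them is reliable; it passes the target at time
    -- `d`.
    found : ∀ σ (E : Execution algorithm f) {d} → 0# ≤ d → Execution.target E ≡ signed σ d →
            Found E d
    found σ E {d} 0≤d target≡ with em {Σ[ i ∈ Fin n ] i ∈ group σ × i ∉ Execution.faulty E}
    ... | yes (i , i∈σ , i∉F) = i , i∉F , d , 0≤d , ≤-refl ,
      trans (follows i i∉F d 0≤d) (trans (position-running σ i∈σ log d) (sym target≡)) ,
      trans (runner-claims E σ i∈σ i∉F 0≤d target≡) (cong just (sym target≡))
      where open Execution E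
    ... | no none = contradiction
      (ℕ.≤-trans (ℕ.≤-reflexive (sym (size σ))) (ℕ.≤-trans (p⊆q⇒∣p∣≤∣q∣ group⊆faulty) ∣faulty∣))
      (ℕ.<⇒≱ f<a)
      where
      open Execution E
      group⊆faulty : group σ ⊆ faulty
      group⊆faulty {i} i∈σ = decidable-stable (i ∈? faulty) λ i∉F → none (i , i∈σ , i∉F)

    completed : ∀ σ (E : Execution algorithm f) {d} → 0# < d → Execution.target E ≡ signed σ d →
                CompletedBy E (fromℕ 2 * d)
    completed σ E {d} 0<d target≡ =
      let 0≤d = proj₁ 0<d
          d≤2d = x≤x+y d 0≤d
          i , i∉F , s , 0≤s , s≤d , visit , log≡ = found σ E 0≤d target≡
      in d + d , ≤-trans 0≤d d≤2d , ≤-reflexive (sym (fromℕ2* d)) ,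
         (i , i∉F , s , 0≤s , ≤-trans s≤d d≤2d , visit , log≡) , certain σ E 0<d target≡

    search-time : S[ n , f ]≤ fromℕ 2 ·d
    search-time = algorithm , λ where
      d 0<d E (inj₁ target≡d)  → completed rightward E 0<d target≡d
      d 0<d E (inj₂ target≡-d) → completed leftward E 0<d target≡-d

-- Group sizes and the asymptotic ratio.

search-time-2d : ExcludedMiddle 0ℓ → (R : CompleteOrderedField) → ∀ f n →
                     10 ℕ.* f ℕ.+ 6 ℕ.≤ 3 ℕ.* n →
                     let open CompleteOrderedField R using (fromℕ)
                     in Search.S[_,_]≤_·d R n f (fromℕ 2)
search-time-2d em R f n 10f+6≤3n =
  Strategy.Correctness.search-time em R f a group disjoint size 4f<3a 2f+a<n
  where
  open +-*-Solver
  a : ℕ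
  -- The least integer above `4f/3`: large enough for `4f<3a`, while leaving as many robots as
  -- possible outside each group.
  a = suc (4 ℕ.* f ℕ./ 3)

  4f<3a : 4 ℕ.* f ℕ.< 3 ℕ.* a
  4f<3a = begin
    suc (4 ℕ.* f)                                   ≡⟨ cong suc (ℕ.m≡m%n+[m/n]*n (4 ℕ.* f) 3) ⟩
    suc (4 ℕ.* f ℕ.% 3) ℕ.+ 4 ℕ.* f ℕ./ 3 ℕ.* 3     ≤⟨ ℕ.+-monoˡ-≤ (4 ℕ.* f ℕ./ 3 ℕ.* 3) (ℕ.m%n<n (4 ℕ.* f) 3) ⟩
    a ℕ.* 3                                         ≡⟨ ℕ.*-comm a 3 ⟩
    3 ℕ.* a                                         ∎
    where open ℕ.≤-Reasoning

  3a≤4f+3 : 3 ℕ.* a ℕ.≤ 4 ℕ.* f ℕ.+ 3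
  3a≤4f+3 = begin
    3 ℕ.* a                        ≡⟨ ℕ.*-comm 3 a ⟩
    3 ℕ.+ 4 ℕ.* f ℕ./ 3 ℕ.* 3      ≡⟨ ℕ.+-comm 3 (4 ℕ.* f ℕ./ 3 ℕ.* 3) ⟩
    4 ℕ.* f ℕ./ 3 ℕ.* 3 ℕ.+ 3      ≤⟨ ℕ.+-monoˡ-≤ 3 (ℕ.m/n*n≤m (4 ℕ.* f) 3) ⟩
    4 ℕ.* f ℕ.+ 3                  ∎
    where open ℕ.≤-Reasoning

  2f+a<n : f ℕ.+ f ℕ.+ a ℕ.< n
  -- Rounding `a` costs up to 3 and the strict inequality another 3, which together make the 6 in
  -- the hypothesis.
  2f+a<n = ℕ.*-cancelˡ-≤ 3 (begin
    3 ℕ.* suc (f ℕ.+ f ℕ.+ a)          ≡⟨ solve 2 (λ f a →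
                                             con 3 :* (con 1 :+ (f :+ f :+ a)) := con 3 :* a :+ (con 6 :* f :+ con 3)) refl f a ⟩
    3 ℕ.* a ℕ.+ (6 ℕ.* f ℕ.+ 3)        ≤⟨ ℕ.+-monoˡ-≤ (6 ℕ.* f ℕ.+ 3) 3a≤4f+3 ⟩
    4 ℕ.* f ℕ.+ 3 ℕ.+ (6 ℕ.* f ℕ.+ 3)  ≡⟨ solve 1 (λ f →
                                             con 4 :* f :+ con 3 :+ (con 6 :* f :+ con 3) := con 10 :* f :+ con 6) refl f ⟩
    10 ℕ.* f ℕ.+ 6                     ≤⟨ 10f+6≤3n ⟩
    3 ℕ.* n                            ∎)
    where open ℕ.≤-Reasoning

  -- Makes the two groups fit: `a + a ≤ 1 + 2f + a ≤ n`.
  a≤1+2f : a ℕ.≤ suc (f ℕ.+ f)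
  a≤1+2f = ℕ.*-cancelˡ-≤ 3 (begin
    3 ℕ.* a                ≤⟨ 3a≤4f+3 ⟩
    4 ℕ.* f ℕ.+ 3          ≤⟨ ℕ.+-monoˡ-≤ 3 (ℕ.*-monoˡ-≤ f (ℕ.m≤m+n 4 2)) ⟩
    6 ℕ.* f ℕ.+ 3          ≡⟨ solve 1 (λ f → con 6 :* f :+ con 3 := con 3 :* (con 1 :+ (f :+ f))) refl f ⟩
    3 ℕ.* suc (f ℕ.+ f)    ∎)
    where open ℕ.≤-Reasoning

  a+a≤n : a ℕ.+ a ℕ.≤ n
  a+a≤n = ℕ.≤-trans (ℕ.+-monoˡ-≤ a a≤1+2f) 2f+a<n

  rightGroup : Σ[ p ∈ Subset n ] p ⊆ ⊤ × ∣ p ∣ ≡ a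
  rightGroup = subset-of-size a ⊤
    (subst (a ℕ.≤_) (sym (∣⊤∣≡n n)) (ℕ.≤-trans (ℕ.m≤m+n a a) a+a≤n))

  ∣right∣≡a : ∣ proj₁ rightGroup ∣ ≡ a
  ∣right∣≡a = proj₂ (proj₂ rightGroup)

  leftGroup : Σ[ p ∈ Subset n ] p ⊆ ∁ (proj₁ rightGroup) × ∣ p ∣ ≡ a
  leftGroup = subset-of-size a (∁ (proj₁ rightGroup))
    (subst (a ℕ.≤_) (sym (trans (∣∁p∣≡n∸∣p∣ (proj₁ rightGroup)) (cong (n ℕ.∸_) ∣right∣≡a)))
      (ℕ.m+n≤o⇒m≤o∸n a a+a≤n))

  group : Direction → Subset n
  group leftward  = proj₁ leftGroup
  group rightward = proj₁ rightGroup

  size : ∀ σ → ∣ group σ ∣ ≡ a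
  size leftward  = proj₂ (proj₂ leftGroup)
  size rightward = ∣right∣≡a

  disjoint : ∀ σ → group (opposite σ) ⊆ ∁ (group σ)
  disjoint rightward = proj₁ (proj₂ leftGroup)
  disjoint leftward i∈right = x∉p⇒x∈∁p λ i∈left →
    x∈∁p⇒x∉p (proj₁ (proj₂ leftGroup) i∈left) i∈right

corollary1 : ExcludedMiddle 0ℓ →
    (R : CompleteOrderedField) →
    let open CompleteOrderedField R
        open Search R
    in (β : Carrier) → 0# < β → β ≤ fromℕ 3 / fromℕ 10 → Ŝ[ β ]≤ fromℕ 2
-- The ratio and the additive constant are both `fromℕ 2`, the latter uniformly in `β`.
corollary1 em R β 0<β β≤3/10 = fromℕ 2 , (fromℕ 2 , λ f _ →
    let n , n-ceiling = ceiling em (fromℕ f / β + fromℕ 2)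
                          (≤-trans (0≤fromℕ/ 0<β f) (x≤x+y _ (0≤fromℕ 2)))
    in n , n-ceiling , search-time-2d em R f n
         (density-bound 0<β β≤3/10 f n (proj₁ n-ceiling))) ,
  ≤-refl
  where
  open CompleteOrderedField R
  open OrderedField R
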